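{- Let $\mathcal{A}=(A,\{\to_{1,\alpha}\}_{\alpha\in I})$ and $\mathcal{B}=(A,\{\to_{2,\beta}\}_{\beta\in I})$ be $I$-indexed ARSs on the same set $A$, and let $>$ be a well-founded order on $I$ having a least element $\bot$. Suppose $\to_{1,\bot}$ and $\to_{2,\bot}$ commute. If every local peak $b\;{}_{1,\alpha}\!\!\leftarrow a\to_{2,\beta} c$ with $(\alpha,\beta)\in I^2\setminus\{(\bot,\bot)\}$ is decreasing, then $\mathcal{A}$ and $\mathcal{B}$ commute.
   Context: An $I$-indexed abstract rewrite system (ARS) is a pair $(A,\{\to_\alpha\}_{\alpha\in I})$ of a set and a family of binary relations on it; $\to_\mathcal{A}$ is the union of all its relations. Relations $\to_1,\to_2$ commute if ${}_1\!\!\leftarrow^*\cdot\to_2^*\;\subseteq\;\to_2^*\cdot{}_1\!\!\leftarrow^*$; ARSs $\mathcal{A},\mathcal{B}$ commute if $\to_\mathcal{A}$ and $\to_\mathcal{B}$ commute. For $\alpha\in I$, $\curlyvee\alpha=\{\gamma\in I\mid\alpha>\gamma\}$ and $\curlyvee\alpha\beta=\curlyvee\alpha\cup\curlyvee\beta$. For $K\subseteq I$, $\leftrightarrow_K$ is the union of ${}_{1,\gamma}\!\!\leftarrow$ and $\to_{2,\gamma}$ over $\gamma\in K$. A local peak $b\;{}_{1,\alpha}\!\!\leftarrow a\to_{2,\beta} c$ is decreasing if $b\leftrightarrow^*_{\curlyvee\alpha}\cdot\to^=_{2,\beta}\cdot\leftrightarrow^*_{\curlyvee\alpha\beta}\cdot{}_{1,\alpha}\!\!\leftarrow^=\cdot\leftrightarrow^*_{\curlyvee\beta}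 c$, where $\to^=$ denotes the reflexive closure. -}

module Defs where

open import Level using (Level; _⊔_) renaming (suc to lsuc)
open import Data.Product using (_×_; ∃-syntax)
open import Function using (flip)
open import Relation.Unary using (Pred; _∈_) renaming (_∪_ to _∪ᵖ_)
open import Relation.Binary.Core using (Rel; _⇒_)
open import Relation.Binary.Construct.Composition using () renaming (_;_ to _·_)
open import Relation.Binary.Construct.Union using (_∪_)
open import Relation.Binary.Construct.Closure.Reflexive using (ReflClosure)
open import Relation.Binary.Construct.Closure.ReflexiveTransitive using (Star)

-- The carrier is a parameter, so that two systems on the same set are simply
-- two elements of the same type.
ARS : ∀ {i a} → Set i → Set a → (r : Level) → Set (i ⊔ a ⊔ lsuc r)
ARS I A r = I → Rel A r

module _ {i a r : Level} {I : Set i} {A : Set a} where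

  ⋃ : ARS I A r → Rel A (i ⊔ r)
  ⋃ 𝓐 x y = ∃[ α ] 𝓐 α x y

Commute : ∀ {a r s} {A : Set a} → Rel A r → Rel A s → Set (a ⊔ r ⊔ s)
Commute _⟶₁_ _⟶₂_ =
  (flip (Star _⟶₁_) · Star _⟶₂_) ⇒ (Star _⟶₂_ · flip (Star _⟶₁_))

CommuteARS : ∀ {i a r s} {I : Set i} {A : Set a} →
             ARS I A r → ARS I A s → Set (i ⊔ a ⊔ r ⊔ s)
CommuteARS 𝓐 𝓑 = Commute (⋃ 𝓐) (⋃ 𝓑)

module _ {i ℓ : Level} {I : Set i} (_<_ : Rel I ℓ) where

  ⋎ : I → Pred I ℓ
  ⋎ α γ = γ < α

  ⋎₂ : I → I → Pred I ℓ
  ⋎₂ α β = ⋎ α ∪ᵖ ⋎ β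

module _ {i a r s : Level} {I : Set i} {A : Set a}
         (𝓐 : ARS I A r) (𝓑 : ARS I A s) where

  -- Only the first system is reversed: this relation is not symmetric.
  Conv : ∀ {k} → Pred I k → Rel A (i ⊔ k ⊔ r ⊔ s)
  Conv K x y = ∃[ γ ] (γ ∈ K × (flip (𝓐 γ) ∪ 𝓑 γ) x y)

  -- Decreasing _<_ α β b c: the condition on the end points b, c of a local
  -- peak b ₁,α← a →₂,β c; it does not depend on the source a.
  Decreasing : ∀ {ℓ} → Rel I ℓ → I → I → Rel A (i ⊔ a ⊔ ℓ ⊔ r ⊔ s)
  Decreasing _<_ α β =
      Star (Conv (⋎ _<_ α))
    · ReflClosure (𝓑 β)
    · Star (Conv (⋎₂ _<_ α β))
    · flip (ReflClosure (𝓐 α))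
    · Star (Conv (⋎ _<_ β))

{-# OPTIONS --safe #-}

-- A set X is a left wall for a set K of labels if a step x →₂,β y with x ∈ X
-- and β ∈ K can be replaced by a conversion x' ↔*_{⋎β} y with x' ∈ X; right
-- walls are dual. Say that K joins if, whenever a ↔_K-conversion leads from a
-- left wall X to a right wall Y, the two walls meet. The →₂-reducts of b and
-- the →₁-reducts of c are walls for every K, so commutation follows once every
-- conversion lies in some K that joins. {⊥} joins since →₁,⊥ and →₂,⊥ commute.
-- If K is down-closed, joins and contains ⋎α, then local decreasingness of the
-- peaks involving α makes K ∪ {α} join. As a conversion has only finitely many
-- labels, well-founded induction on α then shows that K ∪ {γ ∣ γ ≤ α} joins
-- whenever K does.
module Submission where

open import Defs
open import Level using (Level; Lift; lift; _⊔_)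
open import Data.Product using (_×_; _,_; proj₁; proj₂; ∃-syntax)
open import Data.Sum using (_⊎_; inj₁; inj₂; [_,_]′; swap)
open import Data.Unit.Polymorphic using (⊤)
open import Function using (flip; id; _∘_)
open import Induction.WellFounded using (Acc; acc; WellFounded)
open import Relation.Binary.Core using (Rel)
open import Relation.Binary.Definitions using (Minimum; Transitive)
open import Relation.Binary.Structures using (IsStrictPartialOrder)
open import Relation.Binary.PropositionalEquality using (_≡_; _≢_; refl; sym; cong)
open import Relation.Binary.Construct.Closure.Reflexive using (ReflClosure; [_])
  renaming (refl to refl⁼)
open import Relation.Binary.Construct.Closure.ReflexiveTransitive
  using (Star; ε; _◅_; _◅◅_; return; map; reverse)
open import Relation.Binary.Construct.Composition using () renaming (_;_ to _·_)
open import Relation.Nullary using (¬_; contradiction)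
open import Relation.Unary using (Pred; _∈_; _⊆_; _≬_; _∪_; ｛_｝)

-- Images of sets and conversions

module _ {e p q : Level} {A : Set e} where

  infixl 6 _▹_

  _▹_ : Pred A p → Rel A q → Pred A (e ⊔ p ⊔ q)
  (X ▹ R) y = ∃[ x ] (x ∈ X × R x y)

DownClosed : ∀ {i k ℓ} {I : Set i} → Rel I ℓ → Pred I k → Set (i ⊔ k ⊔ ℓ)
DownClosed _<_ K = ∀ {β} → β ∈ K → ⋎ _<_ β ⊆ K

↓ : ∀ {i ℓ} {I : Set i} → Rel I ℓ → I → Pred I (i ⊔ ℓ)
↓ _<_ α γ = ReflClosure _<_ γ α

module _ {i e r s : Level} {I : Set i} {A : Set e}
         (𝓐 : ARS I A r) (𝓑 : ARS I A s) where

  mapConv : ∀ {k l} {K : Pred I k} {L : Pred I l} → K ⊆ L →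
            ∀ {x y} → Star (Conv 𝓐 𝓑 K) x y → Star (Conv 𝓐 𝓑 L) x y
  mapConv K⊆L = map λ (γ , γ∈K , step) → γ , K⊆L γ∈K , step

  reverseConv : ∀ {k} {K : Pred I k} {x y} →
                Star (Conv 𝓐 𝓑 K) x y → Star (Conv 𝓑 𝓐 K) y x
  reverseConv = reverse λ (γ , γ∈K , step) → γ , γ∈K , swap step

-- Walls

module _ {i e r s ℓ : Level} {I : Set i} {A : Set e}
         (𝓐 : ARS I A r) (𝓑 : ARS I A s) (_<_ : Rel I ℓ) where

  -- A right wall for (𝓐 , 𝓑) is a left wall for (𝓑 , 𝓐).
  Wall : ∀ {k p} → Pred I k → Pred A p → Set _
  Wall K X = ∀ {β x y} → β ∈ K → x ∈ X → 𝓑 β x y →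
             y ∈ X ▹ Star (Conv 𝓐 𝓑 (⋎ _<_ β))

  DecreasingPeaks : I → I → Set _
  DecreasingPeaks α β = ∀ {a b c} → 𝓐 α a b → 𝓑 β a c →
                        Decreasing 𝓐 𝓑 _<_ α β b c

  -- In the decreasing conversion for a peak with labels `α` and `β`, everything before the reversed
  -- `α`-step has labels in `K` and is absorbed by `S`. Everything after it lies below `β`, as a
  -- wall demands.
  Wall-▹⁼ : ∀ {k p} {K : Pred I k} {S : Pred A p} {α} →
            DownClosed _<_ K → ⋎ _<_ α ⊆ K → (∀ β → DecreasingPeaks α β) →
            S ▹ Star (Conv 𝓐 𝓑 K) ⊆ S →
            Wall K (S ▹ flip (ReflClosure (𝓐 α)))
  Wall-▹⁼ down ⋎α⊆K dec closed {β} {y = y} β∈K (z , z∈S , refl⁼) b =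
    y , (y , closed (z , z∈S , return (β , β∈K , inj₂ b)) , refl⁼) , ε
  Wall-▹⁼ {K = K} down ⋎α⊆K dec closed {β} β∈K (z , z∈S , [ a ]) b
    with u , p₁ , v , b⁼ , t , p₂ , w , a⁼ , p₃ ← dec β a b =
    w , (t , closed (z , z∈S , z⟷t) , a⁼) , p₃
    where
    →⁼⊆⟷ : ∀ {x y} → ReflClosure (𝓑 β) x y → Star (Conv 𝓐 𝓑 K) x y
    →⁼⊆⟷ refl⁼ = ε
    →⁼⊆⟷ [ b ] = return (β , β∈K , inj₂ b)
    z⟷t = mapConv 𝓐 𝓑 ⋎α⊆K p₁ ◅◅ →⁼⊆⟷ b⁼
          ◅◅ mapConv 𝓐 𝓑 [ ⋎α⊆K , down β∈K ]′ p₂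

-- Joining label sets and saturated sets

module _ {i e r s ℓ : Level} {I : Set i} {A : Set e}
         (𝓐 : ARS I A r) (𝓑 : ARS I A s) (_<_ : Rel I ℓ) where

  -- The level of `X` and `Y` is high enough to contain conversions over `K`, so that sets built
  -- from conversions can serve as walls too.
  Joins : Pred I (i ⊔ ℓ) → Set _
  Joins K = ∀ {X Y : Pred A (i ⊔ e ⊔ r ⊔ s ⊔ ℓ)} {x y} →
            Wall 𝓐 𝓑 _<_ K X → Wall 𝓑 𝓐 _<_ K Y →
            x ∈ X → Star (Conv 𝓐 𝓑 K) x y → y ∈ Y → X ≬ Y

  DecreasingPeaks-sym : ∀ {α β} → DecreasingPeaks 𝓐 𝓑 _<_ α β →
                        DecreasingPeaks 𝓑 𝓐 _<_ β α
  DecreasingPeaks-sym dec b a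
    with u , p₁ , v , b⁼ , t , p₂ , w , a⁼ , p₃ ← dec a b =
    w , reverseConv 𝓐 𝓑 p₃ , t , a⁼ ,
    v , mapConv 𝓑 𝓐 swap (reverseConv 𝓐 𝓑 p₂) , u , b⁼ , reverseConv 𝓐 𝓑 p₁

  Saturated : ∀ {p} → Pred I (i ⊔ ℓ) → I → Pred A p → Set _
  Saturated K α S = S ▹ Star (Conv 𝓐 𝓑 K) ⊆ S × S ▹ 𝓑 α ⊆ S

module _ {i e r s ℓ : Level} {I : Set i} {A : Set e}
         (𝓐 : ARS I A r) (𝓑 : ARS I A s) (_<_ : Rel I ℓ) where

  Joins-sym : ∀ {K} → Joins 𝓐 𝓑 _<_ K → Joins 𝓑 𝓐 _<_ K
  Joins-sym joins wallX wallY x∈X x⟷y y∈Y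
    with z , z∈Y , z∈X ← joins wallY wallX y∈Y (reverseConv 𝓑 𝓐 x⟷y) x∈X =
    z , z∈X , z∈Y

  module _ {K : Pred I (i ⊔ ℓ)} {α : I}
           (down : DownClosed _<_ K) (⋎α⊆K : ⋎ _<_ α ⊆ K)
           (joins : Joins 𝓐 𝓑 _<_ K)
           (dec : ∀ β → DecreasingPeaks 𝓐 𝓑 _<_ α β)
           (dec′ : ∀ β → DecreasingPeaks 𝓑 𝓐 _<_ α β) where

    -- Given V ∋ v ↔*_K x →₂,α y, the points that reach y by →⁼₂,α · ↔*_K form a
    -- right wall, which therefore meets V.
    Saturated-▹⟷ : {V : Pred A (i ⊔ e ⊔ r ⊔ s ⊔ ℓ)} → Wall 𝓐 𝓑 _<_ K V →
                   V ▹ 𝓑 α ⊆ V ▹ Star (Conv 𝓐 𝓑 K) →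
                   Saturated 𝓐 𝓑 _<_ K α (V ▹ Star (Conv 𝓐 𝓑 K))
    Saturated-▹⟷ {V} wall V→α =
      (λ (_ , (v , v∈V , p) , q) → v , v∈V , p ◅◅ q) , closed-→α
      where
      closed-→α : V ▹ Star (Conv 𝓐 𝓑 K) ▹ 𝓑 α ⊆ V ▹ Star (Conv 𝓐 𝓑 K)
      closed-→α {y} (x , (v , v∈V , v⟷x) , b)
        with joins wall
               (Wall-▹⁼ 𝓑 𝓐 _<_ {S = Star (Conv 𝓑 𝓐 K) y} down ⋎α⊆K dec′
                 λ (_ , p , q) → p ◅◅ q)
               v∈V v⟷x (y , ε , [ b ])
      ... | u , u∈V , _ , y⟷u , refl⁼ = u , u∈V , reverseConv 𝓑 𝓐 y⟷u
      ... | u , u∈V , z , y⟷z , [ b′ ]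
        with w , w∈V , w⟷z ← V→α (u , u∈V , b′) =
        w , w∈V , w⟷z ◅◅ reverseConv 𝓑 𝓐 y⟷z

    -- `Wall-▹⁼` supplies the wall. For its `α`-steps, consider peaks with both labels `α`: the
    -- conversions between the `α`-steps lie below `α`, hence in `K`, and `S` absorbs all that
    -- precedes the reversed `α`-step.
    Saturated-▹⁼▹⟷ : {S : Pred A (i ⊔ e ⊔ r ⊔ s ⊔ ℓ)} →
                     Saturated 𝓐 𝓑 _<_ K α S →
                     Saturated 𝓐 𝓑 _<_ K α
                       (S ▹ flip (ReflClosure (𝓐 α)) ▹ Star (Conv 𝓐 𝓑 K))
    Saturated-▹⁼▹⟷ {S} (closed-⟷ , closed-→α) =
      Saturated-▹⟷ (Wall-▹⁼ 𝓐 𝓑 _<_ down ⋎α⊆K dec closed-⟷) →α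
      where
      closed-→α⁼ : S ▹ ReflClosure (𝓑 α) ⊆ S
      closed-→α⁼ (x , x∈S , refl⁼) = x∈S
      closed-→α⁼ (x , x∈S , [ b ]) = closed-→α (x , x∈S , b)

      →α : S ▹ flip (ReflClosure (𝓐 α)) ▹ 𝓑 α ⊆
           S ▹ flip (ReflClosure (𝓐 α)) ▹ Star (Conv 𝓐 𝓑 K)
      →α {y} (x , (x , x∈S , refl⁼) , b) =
        y , (y , closed-→α (x , x∈S , b) , refl⁼) , ε
      →α (x , (z , z∈S , [ a ]) , b)
        with u , p₁ , v , b⁼ , t , p₂ , w , a⁼ , p₃ ← dec α a b =
        w , (t , t∈S , a⁼) , mapConv 𝓐 𝓑 ⋎α⊆K p₃
        where
        u∈S = closed-⟷ (z , z∈S , mapConv 𝓐 𝓑 ⋎α⊆K p₁)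
        v∈S = closed-→α⁼ (u , u∈S , b⁼)
        t∈S = closed-⟷ (v , v∈S , mapConv 𝓐 𝓑 [ ⋎α⊆K , ⋎α⊆K ]′ p₂)

    -- Induction on the conversion. `S` absorbs every step except a reversed `α`-step, for which it
    -- is enlarged. A meeting point with the enlarged set is traced back into `S` without leaving
    -- `T`, as `T` is closed under conversion over `K` and under `𝓐 α`.
    Saturated-meet : {S T : Pred A (i ⊔ e ⊔ r ⊔ s ⊔ ℓ)} →
                     Saturated 𝓐 𝓑 _<_ K α S → Saturated 𝓑 𝓐 _<_ K α T →
                     ∀ {x y} → x ∈ S → Star (Conv 𝓐 𝓑 (K ∪ ｛ α ｝)) x y →
                     y ∈ T → S ≬ T
    Saturated-meet satS satT {x} x∈S ε x∈T = x , x∈S , x∈T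
    Saturated-meet satS satT x∈S ((γ , inj₁ γ∈K , step) ◅ p) y∈T =
      Saturated-meet satS satT
        (proj₁ satS (_ , x∈S , return (γ , γ∈K , step))) p y∈T
    Saturated-meet satS@(_ , closed) satT x∈S ((_ , inj₂ refl , inj₂ b) ◅ p) y∈T =
      Saturated-meet satS satT (closed (_ , x∈S , b)) p y∈T
    Saturated-meet satS satT@(closed-⟷ , closed-→α) x∈S
                   ((_ , inj₂ refl , inj₁ a) ◅ p) y∈T
      with Saturated-meet (Saturated-▹⁼▹⟷ satS) satT
             (_ , (_ , x∈S , [ a ]) , ε) p y∈T
    ... | t , (v , (_ , v∈S , refl⁼) , v⟷t) , t∈T =
      v , v∈S , closed-⟷ (t , t∈T , reverseConv 𝓐 𝓑 v⟷t)
    ... | t , (v , (z , z∈S , [ a′ ]) , v⟷t) , t∈T =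
      z , z∈S , closed-→α (v , closed-⟷ (t , t∈T , reverseConv 𝓐 𝓑 v⟷t) , a′)

-- Adding labels to a joining set

module _ {i e r s ℓ : Level} {I : Set i} {A : Set e}
         (𝓐 : ARS I A r) (𝓑 : ARS I A s) (_<_ : Rel I ℓ) where

  -- The closures of `X` and `Y` under conversion over `K` are saturated, so they meet. Through the
  -- meeting point, `X` and `Y` are linked by a conversion over `K` alone, to which `joins` applies.
  Joins-insert : ∀ {K α} → DownClosed _<_ K → ⋎ _<_ α ⊆ K →
                 (∀ β → DecreasingPeaks 𝓐 𝓑 _<_ α β) →
                 (∀ β → DecreasingPeaks 𝓐 𝓑 _<_ β α) →
                 Joins 𝓐 𝓑 _<_ K → Joins 𝓐 𝓑 _<_ (K ∪ ｛ α ｝)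
  Joins-insert {K} {α} down ⋎α⊆K decˡ decʳ joins {X} {Y} wallX wallY x∈X p y∈Y
    = let (m , (u , u∈X , u⟷m) , (v , v∈Y , v⟷m)) =
            Saturated-meet 𝓐 𝓑 _<_ down ⋎α⊆K joins decˡ dec′ satX satY
              (_ , x∈X , ε) p (_ , y∈Y , ε)
      in joins wallX-K wallY-K u∈X (u⟷m ◅◅ reverseConv 𝓑 𝓐 v⟷m) v∈Y
    where
    dec′ : ∀ β → DecreasingPeaks 𝓑 𝓐 _<_ α β
    dec′ β = DecreasingPeaks-sym 𝓐 𝓑 _<_ (decʳ β)
    wallX-K : Wall 𝓐 𝓑 _<_ K X
    wallX-K = wallX ∘ inj₁
    wallY-K : Wall 𝓑 𝓐 _<_ K Y
    wallY-K = wallY ∘ inj₁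
    satX : Saturated 𝓐 𝓑 _<_ K α (X ▹ Star (Conv 𝓐 𝓑 K))
    satX = Saturated-▹⟷ 𝓐 𝓑 _<_ down ⋎α⊆K joins decˡ dec′ wallX-K
      λ (x , x∈X , b) → let (z , z∈X , p) = wallX (inj₂ refl) x∈X b
                        in z , z∈X , mapConv 𝓐 𝓑 ⋎α⊆K p
    satY : Saturated 𝓑 𝓐 _<_ K α (Y ▹ Star (Conv 𝓑 𝓐 K))
    satY = Saturated-▹⟷ 𝓑 𝓐 _<_ down ⋎α⊆K (Joins-sym 𝓐 𝓑 _<_ joins) dec′ decˡ wallY-K
      λ (y , y∈Y , a) → let (z , z∈Y , p) = wallY (inj₂ refl) y∈Y a
                        in z , z∈Y , mapConv 𝓑 𝓐 ⋎α⊆K p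

  Joins-resp-⊆⊇ : ∀ {K L} → K ⊆ L → L ⊆ K →
                  Joins 𝓐 𝓑 _<_ K → Joins 𝓐 𝓑 _<_ L
  Joins-resp-⊆⊇ K⊆L L⊆K joins wallX wallY x∈X p y∈Y =
    joins (wallX ∘ K⊆L) (wallY ∘ K⊆L) x∈X (mapConv 𝓐 𝓑 L⊆K p) y∈Y

  -- `K` is arbitrary because it has already grown when the next label arrives. Adding all of
  -- `↓ _<_ γ` keeps it down-closed.
  Extends : Pred I (i ⊔ ℓ) → I → Set _
  Extends K₀ γ = ∀ {K} → K₀ ⊆ K → DownClosed _<_ K →
                 Joins 𝓐 𝓑 _<_ K → Joins 𝓐 𝓑 _<_ (K ∪ ↓ _<_ γ)

  module _ (<-trans : Transitive _<_) where

    DownClosed-∪↓ : ∀ {K : Pred I (i ⊔ ℓ)} {γ} →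
                    DownClosed _<_ K → DownClosed _<_ (K ∪ ↓ _<_ γ)
    DownClosed-∪↓ down (inj₁ β∈K)       δ<β = inj₁ (down β∈K δ<β)
    DownClosed-∪↓ down (inj₂ refl⁼)     δ<β = inj₂ [ δ<β ]
    DownClosed-∪↓ down (inj₂ [ β<γ ])   δ<β = inj₂ [ <-trans δ<β β<γ ]

    -- The labels of the conversion are added to K one at a time.
    Joins-∪ : ∀ {K₀ K} {Q : Pred I ℓ} →
              (∀ {γ} → γ ∈ Q → Extends K₀ γ) → DownClosed _<_ Q →
              K₀ ⊆ K → DownClosed _<_ K →
              Joins 𝓐 𝓑 _<_ K → Joins 𝓐 𝓑 _<_ (K ∪ Q)
    Joins-∪ {K₀} {K} {Q} ext downQ K₀⊆K downK joinsK {X} {Y} {x} wallX wallY x∈X p y∈Y =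
      add-labels id inj₁ downK joinsK ε p y∈Y
      where
      -- The part of the conversion already read lies over `L`. At its end `L` need not exhaust
      -- `K ∪ Q`: walls for `K ∪ Q` are walls for the smaller `L`.
      add-labels : ∀ {L} → K ⊆ L → L ⊆ K ∪ Q → DownClosed _<_ L →
                   Joins 𝓐 𝓑 _<_ L → ∀ {y z} → Star (Conv 𝓐 𝓑 L) x y →
                   Star (Conv 𝓐 𝓑 (K ∪ Q)) y z → z ∈ Y → X ≬ Y
      add-labels K⊆L L⊆ down joins p ε y∈Y =
        joins (wallX ∘ L⊆) (wallY ∘ L⊆) x∈X p y∈Y
      add-labels K⊆L L⊆ down joins p ((γ , inj₁ γ∈K , step) ◅ q) y∈Y =
        add-labels K⊆L L⊆ down joins (p ◅◅ return (γ , K⊆L γ∈K , step)) q y∈Y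
      add-labels K⊆L L⊆ down joins p ((γ , inj₂ γ∈Q , step) ◅ q) y∈Y =
        add-labels (inj₁ ∘ K⊆L) [ L⊆ , inj₂ ∘ ↓γ⊆Q ]′ (DownClosed-∪↓ down)
          (ext γ∈Q (K⊆L ∘ K₀⊆K) down joins)
          (mapConv 𝓐 𝓑 inj₁ p ◅◅ return (γ , inj₂ refl⁼ , step)) q y∈Y
        where
        ↓γ⊆Q : ↓ _<_ γ ⊆ Q
        ↓γ⊆Q refl⁼   = γ∈Q
        ↓γ⊆Q [ δ<γ ] = downQ γ∈Q δ<γ

    -- Labels in `K₀` are exempt from decreasingness; a down-closed `K` above `K₀` already contains
    -- all that lies below them. For any other `α`, the induction hypotheses add `⋎ _<_ α` first,
    -- and then `Joins-insert` adds `α`.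
    Extends-acc : ∀ {K₀} →
                  (∀ α → α ∈ K₀ ⊎ (∀ β → DecreasingPeaks 𝓐 𝓑 _<_ α β
                                        × DecreasingPeaks 𝓐 𝓑 _<_ β α)) →
                  ∀ {α} → Acc _<_ α → Extends K₀ α
    Extends-acc dec {α} (acc rec) {K} K₀⊆K down joins with dec α
    ... | inj₁ α∈K₀ = Joins-resp-⊆⊇ inj₁ [ id , ↓α⊆K ]′ joins
      where
      ↓α⊆K : ↓ _<_ α ⊆ K
      ↓α⊆K refl⁼   = K₀⊆K α∈K₀
      ↓α⊆K [ γ<α ] = down (K₀⊆K α∈K₀) γ<α
    ... | inj₂ decα =
      Joins-resp-⊆⊇ to from
        (Joins-insert down′ inj₂ (proj₁ ∘ decα) (proj₂ ∘ decα) joins′)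
      where
      down⋎ : DownClosed _<_ (⋎ _<_ α)
      down⋎ β<α γ<β = <-trans γ<β β<α
      down′ : DownClosed _<_ (K ∪ ⋎ _<_ α)
      down′ (inj₁ β∈K) γ<β = inj₁ (down β∈K γ<β)
      down′ (inj₂ β<α) γ<β = inj₂ (down⋎ β<α γ<β)
      joins′ : Joins 𝓐 𝓑 _<_ (K ∪ ⋎ _<_ α)
      joins′ =
        Joins-∪ (λ γ<α → Extends-acc dec (rec γ<α)) down⋎ K₀⊆K down joins
      to : (K ∪ ⋎ _<_ α) ∪ ｛ α ｝ ⊆ K ∪ ↓ _<_ α
      to (inj₁ (inj₁ γ∈K)) = inj₁ γ∈K
      to (inj₁ (inj₂ γ<α)) = inj₂ [ γ<α ]
      to (inj₂ refl)       = inj₂ refl⁼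
      from : K ∪ ↓ _<_ α ⊆ (K ∪ ⋎ _<_ α) ∪ ｛ α ｝
      from (inj₁ γ∈K)       = inj₁ (inj₁ γ∈K)
      from (inj₂ refl⁼)     = inj₂ refl
      from (inj₂ [ γ<α ])   = inj₁ (inj₂ γ<α)

  -- The least label

  module _ {⊥ : I} (≮⊥ : ∀ {γ} → ¬ (γ < ⊥)) where

    -- As in the proof that confluence implies the Church-Rosser property: commutation moves a
    -- leading reversed step past the forward half of the valley found for the rest.
    Conv-↓⊥⇒valley : Commute (𝓐 ⊥) (𝓑 ⊥) →
                     ∀ {x y} → Star (Conv 𝓐 𝓑 (↓ _<_ ⊥)) x y →
                     (Star (𝓑 ⊥) · flip (Star (𝓐 ⊥))) x y
    Conv-↓⊥⇒valley commute {x} ε = x , ε , ε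
    Conv-↓⊥⇒valley commute ((_ , [ γ<⊥ ] , _) ◅ _) = contradiction γ<⊥ ≮⊥
    Conv-↓⊥⇒valley commute ((_ , refl⁼ , inj₂ b) ◅ p)
      with v , b* , a* ← Conv-↓⊥⇒valley commute p = v , b ◅ b* , a*
    Conv-↓⊥⇒valley commute ((_ , refl⁼ , inj₁ a) ◅ p)
      with v , b* , a* ← Conv-↓⊥⇒valley commute p
      with w , b*′ , a*′ ← commute (_ , return a , b*) = w , b*′ , a* ◅◅ a*′

    -- The conversion that replaces a `⊥`-step has labels below `⊥`, so it is empty.
    Wall-↓⊥-closed : ∀ {p} {X : Pred A p} → Wall 𝓐 𝓑 _<_ (↓ _<_ ⊥) X →
                     ∀ {x y} → x ∈ X → Star (𝓑 ⊥) x y → y ∈ X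
    Wall-↓⊥-closed wall x∈X ε = x∈X
    Wall-↓⊥-closed wall x∈X (b ◅ b*) with wall refl⁼ x∈X b
    ... | _ , y∈X , ε                  = Wall-↓⊥-closed wall y∈X b*
    ... | _ , _   , (_ , γ<⊥ , _) ◅ _  = contradiction γ<⊥ ≮⊥

  Wall-reducts : ∀ p {k} {K : Pred I k} {b} →
                 Wall 𝓐 𝓑 _<_ K (λ x → Lift p (Star (⋃ 𝓑) b x))
  Wall-reducts p {y = y} _ (lift b→*x) x→y =
    y , lift (b→*x ◅◅ return (_ , x→y)) , ε

theorem6 : ∀ {i e r s ℓ : Level} {I : Set i} {A : Set e}
    (𝓐 : ARS I A r) (𝓑 : ARS I A s)
    (_<_ : Rel I ℓ) → IsStrictPartialOrder _≡_ _<_ → WellFounded _<_ →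
    (⊥ : I) → Minimum (ReflClosure _<_) ⊥ →
    Commute (𝓐 ⊥) (𝓑 ⊥) →
    (∀ {α β : I} {a b c : A} → (α , β) ≢ (⊥ , ⊥) →
    𝓐 α a b → 𝓑 β a c → Decreasing 𝓐 𝓑 _<_ α β b c) →
    CommuteARS 𝓐 𝓑
theorem6 {i} {e} {r} {s} {ℓ} {I} 𝓐 𝓑 _<_ <-spo <-wf ⊥ ⊥-min commute dec
         {b} {c} (a , a→*b , a→*c) =
  let (v , lift b→*v , lift c→*v) =
        joins {X = λ x → Lift (i ⊔ e ⊔ r ⊔ s ⊔ ℓ) (Star (⋃ 𝓑) b x)}
              {Y = λ y → Lift (i ⊔ e ⊔ r ⊔ s ⊔ ℓ) (Star (⋃ 𝓐) c y)}
              (Wall-reducts 𝓐 𝓑 _<_ _ {K = labels})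
              (Wall-reducts 𝓑 𝓐 _<_ _ {K = labels})
              (lift ε) b⟷c (lift ε)
  in v , b→*v , c→*v
  where
  open IsStrictPartialOrder <-spo using (irrefl; trans)

  ≮⊥ : ∀ {γ} → ¬ (γ < ⊥)
  ≮⊥ {γ} γ<⊥ with ⊥-min γ
  ... | refl⁼   = irrefl refl γ<⊥
  ... | [ ⊥<γ ] = irrefl refl (trans ⊥<γ γ<⊥)

  down⊥ : DownClosed _<_ (↓ _<_ ⊥)
  down⊥ refl⁼   γ<⊥ = [ γ<⊥ ]
  down⊥ [ β<⊥ ] γ<β = [ trans γ<β β<⊥ ]

  joins⊥ : Joins 𝓐 𝓑 _<_ (↓ _<_ ⊥)
  joins⊥ wallX wallY x∈X p y∈Y
    with v , b* , a* ← Conv-↓⊥⇒valley 𝓐 𝓑 _<_ ≮⊥ commute p =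
    v , Wall-↓⊥-closed 𝓐 𝓑 _<_ ≮⊥ wallX x∈X b*
      , Wall-↓⊥-closed 𝓑 𝓐 _<_ ≮⊥ wallY y∈Y a*

  -- The proof of minimality itself decides whether `α` is `⊥`.
  ⊥-or-decreasing : ∀ α → α ∈ ↓ _<_ ⊥ ⊎
                    (∀ β → DecreasingPeaks 𝓐 𝓑 _<_ α β × DecreasingPeaks 𝓐 𝓑 _<_ β α)
  ⊥-or-decreasing α with ⊥-min α
  ... | refl⁼   = inj₁ refl⁼
  ... | [ ⊥<α ] = inj₂ λ β → dec (α≢⊥ ∘ cong proj₁) , dec (α≢⊥ ∘ cong proj₂)
    where
    α≢⊥ : α ≢ ⊥
    α≢⊥ α≡⊥ = irrefl (sym α≡⊥) ⊥<α

  -- All labels, in the form of a union that `Joins-∪` yields when started from `↓ _<_ ⊥`.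
  labels : Pred I (i ⊔ ℓ)
  labels = ↓ _<_ ⊥ ∪ λ _ → ⊤

  joins : Joins 𝓐 𝓑 _<_ labels
  joins = Joins-∪ 𝓐 𝓑 _<_ trans
    (λ _ → Extends-acc 𝓐 𝓑 _<_ trans ⊥-or-decreasing (<-wf _)) _ id down⊥ joins⊥

  b⟷c : Star (Conv 𝓐 𝓑 labels) b c
  b⟷c = reverse (λ (γ , a) → γ , inj₂ _ , inj₁ a) a→*b
     ◅◅ map (λ (γ , b) → γ , inj₂ _ , inj₂ b) a→*c
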